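{- Let $f:\mathbb{N}\to\mathbb{N}$ be an unbounded non-decreasing function with $f(x)\le x$ for all $x$, and define $g:\mathbb{N}\to\mathbb{N}$ by $g(p)=\max\{i: f(i)\le p\}$. Then for every finite simple graph $G$ and every non-negative integer $r$, $$\nabla_r(G)\le N_f(G,2r+1)^{2r+1}\, g(2r+1)^2.$$
   Context: For a finite simple graph $G$, a function $f:\mathbb{N}\to\mathbb{N}$ and a positive integer $p$, $N_f(G,p)$ denotes the minimum number of colours in a colouring of the edges of $G$ such that every cycle $\gamma$ of $G$ receives at least $\min(f(|\gamma|),p+1)$ distinct colours, where $|\gamma|$ is the length of $\gamma$. A simple graph $H$ is a shallow minor of $G$ at depth $r$ if there are pairwise vertex-disjoint subtrees $T_1,\dots,T_k$ of $G$, each having a root from which every vertex of the tree is at distance at most $r$ in the tree, such that $H$ is isomorphic to a subgraph of the graph with vertex set $\{T_1,\dots,T_k\}$ in which $T_i,T_j$ are adjacent iff some edge of $G$ joins a vertex of $T_i$ to a vertex of $T_j$. $\nabla_r(G)$ is the maximum of $\|H\|/|H|$ over all shallow minors $H$ of $G$ at depth $r$, where $\|H\|$ is the number of edges and $|H|$ the number of vertices. -}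

module Defs where

open import Level using (Level; 0ℓ; _⊔_)
open import Data.Nat as ℕ using (ℕ; zero; suc; _≤_; _<_; _⊓_)
open import Data.Integer using (+_)
open import Data.Rational as ℚ using (ℚ; 0ℚ)
open import Data.Fin as Fin using (Fin)
open import Data.Fin.Properties using (_≟_; any?)
open import Data.List using (List; []; _∷_; length; filter; deduplicate; cartesianProduct; allFin)
open import Data.List.Relation.Unary.Unique.Propositional using (Unique)
open import Data.Product using (Σ-syntax; ∃-syntax; _×_; _,_)
open import Function using (flip; _∘_; Injective)
open import Relation.Binary using (Rel; Decidable; Symmetric)
open import Relation.Binary.Construct.Closure.ReflexiveTransitive using (Star; ε; _◅_)
open import Relation.Binary.PropositionalEquality using (_≡_; _≢_; refl; sym)
open import Relation.Nullary using (¬_)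
open import Relation.Nullary.Decidable using (_×-dec_; ¬?)
open import Relation.Unary using (Pred)

private
  variable
    a ℓ p : Level

Greatest : {A : Set a} → Rel A ℓ → Pred A p → Pred A (a ⊔ ℓ ⊔ p)
Greatest _≼_ P x = P x × (∀ y → P y → y ≼ x)

Least : {A : Set a} → Rel A ℓ → Pred A p → Pred A (a ⊔ ℓ ⊔ p)
Least _≼_ = Greatest (flip _≼_)

Unbounded : (ℕ → ℕ) → Set
Unbounded f = ∀ m → ∃[ i ] m < f i

record Graph : Set₁ where
  infix 4 _~_ _~?_
  field
    order    : ℕ
    _~_      : Rel (Fin order) 0ℓ
    _~?_     : Decidable _~_
    ~-sym    : Symmetric _~_
    ~-irrefl : ∀ {v} → ¬ (v ~ v)

  Vertex : Set
  Vertex = Fin order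

  Walk : Rel Vertex 0ℓ
  Walk = Star _~_

  walkLength : ∀ {u v} → Walk u v → ℕ
  walkLength ε       = 0
  walkLength (_ ◅ w) = suc (walkLength w)

  vertices : ∀ {u v} → Walk u v → List Vertex
  vertices {u} ε       = u ∷ []
  vertices {u} (_ ◅ w) = u ∷ vertices w

  -- Each edge {u , v} is counted once, as the pair with u < v.
  size : ℕ
  size = length (filter (λ (u , v) → (u Fin.<? v) ×-dec (u ~? v))
                        (cartesianProduct (allFin order) (allFin order)))

  -- A cycle is a path with at least two edges together with an edge joining
  -- its last vertex to its first.
  record Cycle : Set where
    field
      {start end} : Vertex
      path        : Walk start end
      distinct    : Unique (vertices path)
      long        : 2 ≤ walkLength path
      closing     : end ~ start

    cycleLength : ℕ
    cycleLength = suc (walkLength path)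

  -- Comparing arbitrary adjacency proofs in the two directions makes the
  -- colour depend on the unordered pair {u , v} only.
  record EdgeColouring (k : ℕ) : Set where
    field
      colour     : ∀ {u v} → u ~ v → Fin k
      colour-sym : ∀ {u v} (e : u ~ v) (e′ : v ~ u) → colour e ≡ colour e′

    walkColours : ∀ {u v} → Walk u v → List (Fin k)
    walkColours ε       = []
    walkColours (e ◅ w) = colour e ∷ walkColours w

    #colours : Cycle → ℕ
    #colours γ = length (deduplicate _≟_ (colour closing ∷ walkColours path))
      where open Cycle γ

  Connected : Set
  Connected = ∀ u v → Walk u v

  Acyclic : Set
  Acyclic = ¬ Cycle

  DistanceAtMost : ℕ → Rel Vertex 0ℓ
  DistanceAtMost r u v = Σ[ w ∈ Walk u v ] walkLength w ≤ r

open Graph using (order; size; Vertex; Cycle; EdgeColouring; Connected; Acyclic; DistanceAtMost)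

-- A graph H embeds in G exactly when it is isomorphic to a (not necessarily
-- induced) subgraph of G.
record Embedding (H G : Graph) : Set where
  private
    module H = Graph H
    module G = Graph G
  field
    to        : H.Vertex → G.Vertex
    injective : Injective _≡_ _≡_ to
    preserves : ∀ {u v} → u H.~ v → to u G.~ to v

-- k colours suffice, in the sense that the colours are taken from Fin k.
Colourable : (ℕ → ℕ) → Graph → ℕ → Pred ℕ 0ℓ
Colourable f G p k =
  Σ[ c ∈ EdgeColouring G k ]
    (∀ (γ : Cycle G) →
      f (Graph.Cycle.cycleLength γ) ⊓ suc p ≤ Graph.EdgeColouring.#colours c γ)

-- N is N_f(G, p).
IsN : (ℕ → ℕ) → Graph → ℕ → Pred ℕ 0ℓ
IsN f G p = Least _≤_ (Colourable f G p)

-- A subtree of G is presented as a tree together with an embedding in G; the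
-- root makes it nonempty.
record RootedSubtree (G : Graph) (r : ℕ) : Set₁ where
  field
    tree      : Graph
    connected : Connected tree
    acyclic   : Acyclic tree
    embedding : Embedding tree G
    root      : Vertex tree
    depth     : ∀ v → DistanceAtMost tree r root v

  open Embedding embedding public using (to)

open RootedSubtree using (tree; to)

Disjoint : ∀ {G r k} → (Fin k → RootedSubtree G r) → Set
Disjoint Ts = ∀ {i j} → i ≢ j → ∀ u v → to (Ts i) u ≢ to (Ts j) v

module _ {G : Graph} {r k : ℕ} (Ts : Fin k → RootedSubtree G r) where
  open Graph G using (_~_; _~?_; ~-sym)

  contraction : Graph
  contraction = record
    { order    = k
    ; _~_      = λ i j → i ≢ j × ∃[ u ] ∃[ v ] to (Ts i) u ~ to (Ts j) v
    ; _~?_     = λ i j → ¬? (i ≟ j) ×-dec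
                         any? (λ u → any? (λ v → to (Ts i) u ~? to (Ts j) v))
    ; ~-sym    = λ (i≢j , u , v , e) → (i≢j ∘ sym) , v , u , ~-sym e
    ; ~-irrefl = λ (i≢i , _) → i≢i refl
    }

record ShallowMinor (r : ℕ) (H G : Graph) : Set₁ where
  field
    {k}       : ℕ
    Ts        : Fin k → RootedSubtree G r
    disjoint  : Disjoint Ts
    embedding : Embedding H (contraction Ts)

-- The ratio is 0 by convention for the null graph, so that the maximum below
-- is also defined (and equal to 0) when G has no vertices; for all other G
-- this does not affect it.
density : Graph → ℚ
density H = ratio (size H) (order H)
  where
  ratio : ℕ → ℕ → ℚ
  ratio m zero    = 0ℚ
  ratio m (suc n) = + m ℚ./ suc n

-- q is ∇_r(G).
Is∇ : ℕ → Graph → Pred ℚ _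
Is∇ r G = Greatest ℚ._≤_ (λ q → Σ[ H ∈ Graph ] ShallowMinor r H G × density H ≡ q)

{-# OPTIONS --safe #-}
-- Put p = 2r+1 and d = g(p). An edge of a depth-r minor H corresponds to a walk
-- of length at most p between the roots of two trees, whose colours all occur in
-- some word of length p over the N colours; so N^p words cover the edges of H.
-- For a fixed word C, the edges of H assigned to C form a minor of the subgraph of
-- G spanned by the colours in C, and cycles of this minor lift to cycles at least
-- as long in that subgraph. These carry at most p colours, hence have length at
-- most d. A graph all of whose cycles have length at most d has at most d edges
-- per vertex, since the start of a maximal path in a graph of minimum degree
-- greater than d lies on a cycle of length greater than d. Summing over the words
-- gives density at most N^p d, and d ≤ d² because d ≥ 1.

module Submission where

open import Defs
open import Data.Nat using (ℕ; zero; suc; _≤_; _<_; _+_; _*_; _^_; _⊓_; z≤n; s≤s)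
open import Data.Nat.Properties
open import Algebra.Properties.CommutativeSemigroup +-commutativeSemigroup using (x∙yz≈y∙xz)
open import Data.Integer as ℤ using (+_)
import Data.Integer.Properties as ℤ
open import Data.Rational as ℚ using (ℚ)
import Data.Rational.Properties as ℚ
open import Data.Rational.Unnormalised using (mkℚᵘ; *≤*)
import Data.Rational.Unnormalised.Properties as ℚᵘ
open import Data.Fin as Fin using (Fin)
import Data.Fin.Properties as Fin
open import Data.List using (List; []; _∷_; [_]; _++_; length; filter; map; take; cartesianProduct; cartesianProductWith; allFin)
open import Data.List.Properties using (length-++; length-map; length-take; length-tabulate; filter-++; filter-accept; filter-reject; filter-none)
open import Data.List.Membership.Propositional using (_∈_; _∉_; find; lose)
import Data.List.Membership.DecPropositional as DecMembership
open import Data.List.Membership.Propositional.Properties using (∈-∃++; ∈-filter⁻; ∈-allFin; ∈-deduplicate⁻; ∈-cartesianProductWith⁺)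
open import Data.List.Relation.Binary.Permutation.Propositional using (_↭_; refl; prep; swap; trans; ↭⇒↭ₛ)
open import Data.List.Relation.Binary.Permutation.Propositional.Properties using (shift; ↭-length; filter-↭; ∈-resp-↭)
import Data.List.Relation.Binary.Permutation.Setoid.Properties as Permutation
open import Data.List.Relation.Binary.Sublist.Propositional using (⊆-refl; _∷ʳ_)
import Data.List.Relation.Binary.Sublist.Propositional.Properties as Sublist
open import Data.List.Relation.Binary.Subset.Propositional using (_⊆_)
open import Data.List.Relation.Unary.All as All using (All; []; _∷_)
import Data.List.Relation.Unary.All.Properties as All
open import Data.List.Relation.Unary.AllPairs as AllPairs using (AllPairs; []; _∷_)
open import Data.List.Relation.Unary.AllPairs.Properties using (tabulate⁺-<)
open import Data.List.Relation.Unary.Any using (Any; here; there; any?)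
open import Data.List.Relation.Unary.Unique.Propositional using (Unique)
open import Data.List.Relation.Unary.Unique.DecPropositional.Properties using (deduplicate-!)
open import Data.List.Relation.Unary.Unique.Propositional.Properties using (filter⁺; allFin⁺; ++⁺; Unique[x∷xs]⇒x∉xs)
open import Data.Product using (Σ-syntax; ∃-syntax; _×_; _,_; proj₁; proj₂)
open import Data.Sum as Sum using (_⊎_; inj₁; inj₂)
open import Data.Vec as Vec using (Vec; []; _∷_; toList)
open import Data.Vec.Properties using (length-toList)
open import Function using (_∘_; id)
open import Level using (Level; 0ℓ)
open import Relation.Binary using (Rel; _Preserves_⟶_)
open import Relation.Binary.Construct.Closure.ReflexiveTransitive using (Star; ε; _◅_; _◅◅_; gmap; reverse)
open import Relation.Binary.PropositionalEquality using (_≡_; _≢_; refl; sym; cong; subst; setoid; module ≡-Reasoning)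
import Relation.Binary.PropositionalEquality as ≡
open import Relation.Nullary using (¬_; Dec; yes; no; contradiction)
open import Relation.Nullary.Decidable using (_×-dec_; _⊎-dec_; ¬?; decidable-stable)
open import Relation.Unary using (Pred; Decidable)

private
  variable
    a ℓ₁ ℓ₂ ℓ₃ : Level
    A B : Set a

-- Counting in lists

module _ {P : Pred A ℓ₁} {Q : Pred A ℓ₂} (P? : Decidable P) (Q? : Decidable Q) where

  length-filter-mono : (∀ {x} → P x → Q x) → ∀ xs → length (filter P? xs) ≤ length (filter Q? xs)
  length-filter-mono P⇒Q xs =
    Sublist.length-mono-≤ (Sublist.filter⁺ P? Q? (λ { refl → P⇒Q }) (⊆-refl {x = xs}))

module _ {P : Pred A ℓ₁} (P? : Decidable P) where

  length-filter-∷ : ∀ x xs → length (filter P? xs) ≤ length (filter P? (x ∷ xs))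
  length-filter-∷ x xs = Sublist.length-mono-≤ (Sublist.filter⁺ P? P? (λ { refl → id }) (x ∷ʳ ⊆-refl))

  length-filter-map : (f : B → A) → ∀ xs → length (filter P? (map f xs)) ≡ length (filter (P? ∘ f) xs)
  length-filter-map f []       = refl
  length-filter-map f (x ∷ xs) with P? (f x)
  ... | yes _ = cong suc (length-filter-map f xs)
  ... | no  _ = length-filter-map f xs

module _ {P : Pred A ℓ₁} {Q : Pred A ℓ₂} {R : Pred A ℓ₃}
         (P? : Decidable P) (Q? : Decidable Q) (R? : Decidable R) where

  length-filter-∪ : (∀ {x} → P x → Q x ⊎ R x) →
                    ∀ xs → length (filter P? xs) ≤ length (filter Q? xs) + length (filter R? xs)
  length-filter-∪ P⊆Q∪R []       = z≤n
  length-filter-∪ P⊆Q∪R (x ∷ xs) with P? x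
  ... | no  _  = ≤-trans (length-filter-∪ P⊆Q∪R xs)
                         (+-mono-≤ (length-filter-∷ Q? x xs) (length-filter-∷ R? x xs))
  ... | yes px with P⊆Q∪R px
  ...   | inj₁ qx rewrite filter-accept Q? {xs = xs} qx =
    s≤s (≤-trans (length-filter-∪ P⊆Q∪R xs) (+-monoʳ-≤ _ (length-filter-∷ R? x xs)))
  ...   | inj₂ rx rewrite filter-accept R? {xs = xs} rx
                        | +-suc (length (filter Q? (x ∷ xs))) (length (filter R? xs)) =
    s≤s (≤-trans (length-filter-∪ P⊆Q∪R xs) (+-monoˡ-≤ _ (length-filter-∷ Q? x xs)))

-- Union bound by induction on `cs`: the elements in `Q c` number at most `b`, and the others are
-- passed to the remaining indices with `¬ Q c` added to the predicate.
length-filter-⋃ : ∀ {C : Set a} {Q : C → Pred A ℓ₂} (Q? : ∀ c → Decidable (Q c)) {b} xs →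
                  (∀ c → length (filter (Q? c) xs) ≤ b) →
                  ∀ cs {P : Pred A ℓ₁} (P? : Decidable P) → (∀ {x} → P x → Any (λ c → Q c x) cs) →
                  length (filter P? xs) ≤ length cs * b
length-filter-⋃ Q? xs bound [] P? P⊆⋃Q
  rewrite filter-none P? {xs} (All.tabulate λ _ px → contradiction (P⊆⋃Q px) λ ()) = z≤n
length-filter-⋃ {Q = Q} Q? {b} xs bound (c ∷ cs) {P} P? P⊆⋃Q = begin
  length (filter P? xs)                                   ≤⟨ length-filter-∪ P? (Q? c) rest? split xs ⟩
  length (filter (Q? c) xs) + length (filter rest? xs)    ≤⟨ +-mono-≤ (bound c) (length-filter-⋃ Q? xs bound cs rest? later) ⟩
  b + length cs * b                                       ∎
  where
  open ≤-Reasoning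
  rest? : Decidable (λ x → P x × ¬ Q c x)
  rest? x = P? x ×-dec ¬? (Q? c x)
  split : ∀ {x} → P x → Q c x ⊎ (P x × ¬ Q c x)
  split {x} px with Q? c x
  ... | yes qx = inj₁ qx
  ... | no ¬qx = inj₂ (px , ¬qx)
  later : ∀ {x} → P x × ¬ Q c x → Any (λ c → Q c x) cs
  later (px , ¬qx) with P⊆⋃Q px
  ... | here qx  = contradiction qx ¬qx
  ... | there q  = q

∈⇒↭ : ∀ {x : A} {xs} → x ∈ xs → ∃[ ys ] xs ↭ x ∷ ys
∈⇒↭ x∈xs with ∈-∃++ x∈xs
... | ys , zs , refl = ys ++ zs , shift _ ys zs

-- Pigeonhole: bring the head `x` to the front of `ys` and delete it. The tail is still contained in
-- what is left, because `x` does not recur in it.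
unique-⊆⇒length≤ : {xs ys : List A} → Unique xs → xs ⊆ ys → length xs ≤ length ys
unique-⊆⇒length≤ {xs = []}     _            _   = z≤n
unique-⊆⇒length≤ {xs = x ∷ xs} u@(_ ∷ u′) x∷xs⊆ys with ∈⇒↭ (x∷xs⊆ys (here refl))
... | zs , ys↭x∷zs rewrite ↭-length ys↭x∷zs = s≤s (unique-⊆⇒length≤ u′ xs⊆zs)
  where
  xs⊆zs : xs ⊆ zs
  xs⊆zs z∈xs with ∈-resp-↭ ys↭x∷zs (x∷xs⊆ys (there z∈xs))
  ... | here refl = contradiction z∈xs (Unique[x∷xs]⇒x∉xs u)
  ... | there z∈zs = z∈zs

length-cartesianProductWith : ∀ {C : Set a} (f : A → B → C) xs ys →
                              length (cartesianProductWith f xs ys) ≡ length xs * length ys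
length-cartesianProductWith f []       ys = refl
length-cartesianProductWith f (x ∷ xs) ys
  rewrite length-++ (map (f x) ys) {cartesianProductWith f xs ys} | length-map (f x) ys =
  ≡.cong₂ _+_ refl (length-cartesianProductWith f xs ys)

words : ∀ k n → List (Vec (Fin k) n)
words k zero    = [ [] ]
words k (suc n) = cartesianProductWith _∷_ (allFin k) (words k n)

length-words : ∀ k n → length (words k n) ≡ k ^ n
length-words k zero    = refl
length-words k (suc n) = ≡.trans (length-cartesianProductWith _∷_ (allFin k) (words k n))
                                 (≡.cong₂ _*_ (length-tabulate {n = k} id) (length-words k n))

∈-words : ∀ {k n} (c : Vec (Fin k) n) → c ∈ words k n
∈-words []      = here refl
∈-words (i ∷ c) = ∈-cartesianProductWith⁺ _∷_ (∈-allFin i) (∈-words c)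

-- The letter `x` serves as padding; it has to be supplied because the alphabet may be empty.
short⇒⊆word : ∀ {n} (x : A) (xs : List A) → length xs ≤ n → ∃[ c ] xs ⊆ toList {n = n} c
short⇒⊆word {n = n}     x []       _          = Vec.replicate n x , λ ()
short⇒⊆word {n = suc n} x (y ∷ xs) (s≤s xs≤n) with short⇒⊆word x xs xs≤n
... | c , xs⊆c = y ∷ c , λ { (here refl) → here refl ; (there z∈xs) → there (xs⊆c z∈xs) }

_∈?_ : ∀ {n} (i : Fin n) is → Dec (i ∈ is)
_∈?_ = DecMembership._∈?_ Fin._≟_

-- Graphs without long cycles

module _ (K : Graph) where
  open Graph K

  -- The last component turns a position into a length: a vertex missing from the first `n` entries
  -- is at least `n` steps along the path. This is what makes the cycle closed in `longCycle` long.
  prefixTo : ∀ {u v x} (w : Walk u v) → x ∈ vertices w → Unique (vertices w) →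
             Σ[ w′ ∈ Walk u x ] Unique (vertices w′) × vertices w′ ⊆ vertices w ×
               (∀ n → x ∉ take n (vertices w) → n ≤ walkLength w′)
  prefixTo ε       (here refl)  u       = ε , u , id ,
    λ { zero _ → z≤n ; (suc _) x∉ → contradiction (here refl) x∉ }
  prefixTo (e ◅ w) (here refl)  _       = ε , [] ∷ [] , (λ { (here refl) → here refl }) ,
    λ { zero _ → z≤n ; (suc _) x∉ → contradiction (here refl) x∉ }
  prefixTo (e ◅ w) (there x∈w) (u∉w ∷ uw) with prefixTo w x∈w uw
  ... | w′ , uw′ , w′⊆w , long = e ◅ w′ , All.tabulate (All.lookup u∉w ∘ w′⊆w) ∷ uw′ ,
    (λ { (here refl) → here refl ; (there y∈) → there (w′⊆w y∈) }) ,
    λ { zero _ → z≤n ; (suc n) x∉ → s≤s (long n (x∉ ∘ there)) }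

  suffixFrom : ∀ {u v x} (w : Walk u v) → x ∈ vertices w → Unique (vertices w) →
               Σ[ w′ ∈ Walk x v ] Unique (vertices w′) × vertices w′ ⊆ vertices w
  suffixFrom ε       (here refl)  u = ε , u , id
  suffixFrom (e ◅ w) (here refl)  u = e ◅ w , u , id
  suffixFrom (e ◅ w) (there x∈w) (_ ∷ uw) with suffixFrom w x∈w uw
  ... | w′ , uw′ , w′⊆w = w′ , uw′ , there ∘ w′⊆w

  vertices-◅◅ : ∀ {u v x y} (w : Walk u v) (e : v ~ x) (w′ : Walk x y) →
                vertices (w ◅◅ e ◅ w′) ≡ vertices w ++ vertices w′
  vertices-◅◅ ε       e w′ = refl
  vertices-◅◅ (d ◅ w) e w′ = cong (_ ∷_) (vertices-◅◅ w e w′)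

  walkLength-◅◅ : ∀ {u v x y} (w : Walk u v) (e : v ~ x) (w′ : Walk x y) →
                  walkLength w′ < walkLength (w ◅◅ e ◅ w′)
  walkLength-◅◅ ε       e w′ = ≤-refl
  walkLength-◅◅ (d ◅ w) e w′ = m≤n⇒m≤1+n (walkLength-◅◅ w e w′)

  degree : Vertex → List Vertex → ℕ
  degree v S = length (filter (v ~?_) S)

  -- For a list without repetitions this is the number of edges induced on it, each counted at the
  -- endpoint that comes first, so that deleting the head loses exactly its degree.
  edges : List Vertex → ℕ
  edges []      = 0
  edges (v ∷ S) = degree v S + edges S

  degree-↭ : ∀ v {S T} → S ↭ T → degree v S ≡ degree v T
  degree-↭ v S↭T = ↭-length (filter-↭ (v ~?_) S↭T)

  -- Swapping two neighbouring entries only moves the edge between them, if there is one, from one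
  -- degree to the other, by symmetry of adjacency. Hence any vertex may be treated as the head.
  edges-↭ : ∀ {S T} → S ↭ T → edges S ≡ edges T
  edges-↭ refl                  = refl
  edges-↭ (prep v S↭T)          = ≡.cong₂ _+_ (degree-↭ v S↭T) (edges-↭ S↭T)
  edges-↭ (trans S↭T T↭U)       = ≡.trans (edges-↭ S↭T) (edges-↭ T↭U)
  edges-↭ (swap {S} {T} u v S↭T) =
    ≡.trans (exchange S) (≡.cong₂ _+_ (degree-↭ v (prep u S↭T)) (≡.cong₂ _+_ (degree-↭ u S↭T) (edges-↭ S↭T)))
    where
    exchange : ∀ S → edges (u ∷ v ∷ S) ≡ edges (v ∷ u ∷ S)
    exchange S with u ~? v | v ~? u
    ... | yes e | no ¬e = contradiction (~-sym e) ¬e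
    ... | no ¬e | yes e = contradiction (~-sym e) ¬e
    ... | yes _ | yes _ = cong suc (x∙yz≈y∙xz (degree u S) (degree v S) (edges S))
    ... | no  _ | no  _ = x∙yz≈y∙xz (degree u S) (degree v S) (edges S)

  private
    edge? : Decidable (λ ((u , v) : Vertex × Vertex) → u Fin.< v × u ~ v)
    edge? (u , v) = (u Fin.<? v) ×-dec (u ~? v)

    #pairs : List Vertex → List Vertex → ℕ
    #pairs X Y = length (filter edge? (cartesianProduct X Y))

    #pairs-∷ : ∀ x X Y → #pairs (x ∷ X) Y ≡ length (filter (edge? ∘ (x ,_)) Y) + #pairs X Y
    #pairs-∷ x X Y = begin
      length (filter edge? (map (x ,_) Y ++ XY))                      ≡⟨ cong length (filter-++ edge? (map (x ,_) Y) XY) ⟩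
      length (filter edge? (map (x ,_) Y) ++ filter edge? XY)         ≡⟨ length-++ (filter edge? (map (x ,_) Y)) ⟩
      length (filter edge? (map (x ,_) Y)) + length (filter edge? XY)
        ≡⟨ cong (λ m → m + length (filter edge? XY)) (length-filter-map edge? (x ,_) Y) ⟩
      length (filter (edge? ∘ (x ,_)) Y) + length (filter edge? XY)   ∎
      where
      open ≡-Reasoning
      XY = cartesianProduct X Y

    #pairs-drop : ∀ v X Y → All (v Fin.<_) X → #pairs X (v ∷ Y) ≡ #pairs X Y
    #pairs-drop v []      Y []          = refl
    #pairs-drop v (x ∷ X) Y (v<x ∷ v<X)
      rewrite #pairs-∷ x X (v ∷ Y) | #pairs-∷ x X Y
            | filter-reject (edge? ∘ (x ,_)) {xs = Y} (λ (x<v , _) → Fin.<-asym x<v v<x)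
      = ≡.cong₂ _+_ refl (#pairs-drop v X Y v<X)

    #pairs≤edges : ∀ S → AllPairs Fin._<_ S → #pairs S S ≤ edges S
    #pairs≤edges []      _           = z≤n
    #pairs≤edges (v ∷ S) (v<S ∷ S<)
      rewrite #pairs-∷ v S (v ∷ S) | #pairs-drop v S S v<S
            | filter-reject (edge? ∘ (v ,_)) {xs = S} (λ (v<v , _) → Fin.<-irrefl refl v<v)
      = +-mono-≤ (length-filter-mono (edge? ∘ (v ,_)) (v ~?_) proj₂ S) (#pairs≤edges S S<)

  size≤edges : size ≤ edges (allFin order)
  size≤edges = #pairs≤edges (allFin order) (tabulate⁺-< id)

  longCycle : ∀ {d S v} → 1 ≤ d → Unique S → (∀ {u} → u ∈ S → d < degree u S) → v ∈ S →
              ∃[ γ ] d < Cycle.cycleLength γ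
  longCycle {d} {S} 1≤d uS d<deg v∈S = extend order ε ([] ∷ []) v∈S (m≤m+n order 1)
    where
    -- A maximal path starting at u contains all neighbours of u.
    extend : ∀ k {u v} (w : Walk u v) → Unique (vertices w) → u ∈ S → order ≤ k + length (vertices w) →
             ∃[ γ ] d < Cycle.cycleLength γ
    extend k {u} w uw u∈S order≤ with any? (λ x → ¬? (x ∈? vertices w)) (filter (u ~?_) S)
    ... | yes new = grow k order≤ (find new)
      where
      grow : ∀ k → order ≤ k + length (vertices w) →
             ∃[ x ] x ∈ filter (u ~?_) S × x ∉ vertices w → ∃[ γ ] d < Cycle.cycleLength γ
      grow k order≤ (x , x∈N , x∉w) with ∈-filter⁻ (u ~?_) {xs = S} x∈N
      -- With no fuel left, `w` already visits at least `order` distinct vertices, which leaves no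
      -- room for `x`.
      grow zero    order≤ (x , x∈N , x∉w) | x∈S , u~x = contradiction
        (≤-trans (unique-⊆⇒length≤ (All.¬Any⇒All¬ _ x∉w ∷ uw) (λ _ → ∈-allFin _))
                 (≤-reflexive (length-tabulate id)))
        (<⇒≱ (s≤s order≤))
      grow (suc k) order≤ (x , x∈N , x∉w) | x∈S , u~x =
        extend k (~-sym u~x ◅ w) (All.¬Any⇒All¬ _ x∉w ∷ uw) x∈S
          (≤-trans order≤ (≤-reflexive (sym (+-suc k _))))
    -- Now all neighbours of `u` in `S` lie on `w`. One of them beyond the first `d + 1` vertices
    -- closes a long cycle.
    ... | no ¬new with any? (λ x → ¬? (x ∈? (take (suc d) (vertices w)))) (filter (u ~?_) S)
    ...   | yes far = close (find far)
      where
      N⊆w : filter (u ~?_) S ⊆ vertices w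
      N⊆w {x} x∈N = decidable-stable (x ∈? vertices w) λ x∉w → ¬new (lose x∈N x∉w)
      close : ∃[ x ] x ∈ filter (u ~?_) S × x ∉ take (suc d) (vertices w) → ∃[ γ ] d < Cycle.cycleLength γ
      close (x , x∈N , x∉) with prefixTo w (N⊆w x∈N) uw
      ... | w′ , uw′ , _ , long =
        -- Here `1 ≤ d` guarantees the two path edges that a cycle must have.
        record { path = w′ ; distinct = uw′ ; long = ≤-trans (s≤s 1≤d) (long (suc d) x∉)
               ; closing = ~-sym (proj₂ (∈-filter⁻ (u ~?_) {xs = S} x∈N)) } ,
        m≤n⇒m≤1+n (long (suc d) x∉)
    -- Otherwise `u` and its more than `d` neighbours, at least `d + 2` distinct vertices, would fit
    -- into `d + 1` places.
    ...   | no ¬far = contradiction (begin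
      suc (suc d)                              ≤⟨ s≤s (d<deg u∈S) ⟩
      length (u ∷ filter (u ~?_) S)            ≤⟨ unique-⊆⇒length≤ (All.tabulate u≢ ∷ filter⁺ (u ~?_) uS) near ⟩
      length (take (suc d) (vertices w))       ≡⟨ length-take (suc d) (vertices w) ⟩
      suc d ⊓ length (vertices w)              ≤⟨ m⊓n≤m (suc d) _ ⟩
      suc d                                    ∎) (<-irrefl refl)
      where
      open ≤-Reasoning
      u≢ : ∀ {x} → x ∈ filter (u ~?_) S → u ≢ x
      u≢ x∈N refl = ~-irrefl (proj₂ (∈-filter⁻ (u ~?_) {xs = S} x∈N))
      start∈ : ∀ {u v} (w : Walk u v) → u ∈ take (suc d) (vertices w)
      start∈ ε       = here refl
      start∈ (_ ◅ _) = here refl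
      near : u ∷ filter (u ~?_) S ⊆ take (suc d) (vertices w)
      near (here refl)       = start∈ w
      near {x} (there x∈N) = decidable-stable (x ∈? _) λ x∉ → ¬far (lose x∈N x∉)

  -- Either some vertex has degree at most `d` in `S` and is removed, or `longCycle` contradicts
  -- `short`. The recursion runs on `n` because `T` is not a subterm of `S`.
  edges≤ : ∀ {d} → 1 ≤ d → (∀ γ → Cycle.cycleLength γ ≤ d) →
           ∀ n S → Unique S → length S ≡ n → edges S ≤ n * d
  edges≤ 1≤d short n [] uS refl = z≤n
  edges≤ {d} 1≤d short (suc n) S@(_ ∷ _) uS |S|≡ with any? (λ v → degree v S ≤? d) S
  ... | no ¬sparse =
    let (γ , d<γ) = longCycle 1≤d uS (λ u∈S → ≰⇒> (¬sparse ∘ lose u∈S)) (here refl)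
    in contradiction (short γ) (<⇒≱ d<γ)
  ... | yes sparse with find sparse
  ...   | v , v∈S , deg≤d with ∈⇒↭ v∈S
  ...     | T , S↭v∷T = begin
    edges S                   ≡⟨ edges-↭ S↭v∷T ⟩
    degree v T + edges T      ≤⟨ +-mono-≤ degT≤d (edges≤ 1≤d short n T uT |T|≡n) ⟩
    d + n * d                 ∎
    where
    open ≤-Reasoning
    degT≤d : degree v T ≤ d
    degT≤d = ≤-trans (length-filter-∷ (v ~?_) v T)
                     (≤-trans (≤-reflexive (sym (degree-↭ v S↭v∷T))) deg≤d)
    uT : Unique T
    uT = AllPairs.tail (Permutation.Unique-resp-↭ (setoid _) (↭⇒↭ₛ S↭v∷T) uS)
    |T|≡n : length T ≡ n
    |T|≡n = suc-injective (≡.trans (sym (↭-length S↭v∷T)) |S|≡)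

  size≤ : ∀ {d} → 1 ≤ d → (∀ γ → Cycle.cycleLength γ ≤ d) → size ≤ order * d
  size≤ 1≤d short =
    ≤-trans size≤edges (edges≤ 1≤d short order (allFin order) (allFin⁺ order) (length-tabulate id))

-- Cycles of minors

module _ (G : Graph) where
  open Graph G

  -- Both ends are required to lie in `B`, which makes the relation symmetric, so that walks inside
  -- `B` can be reversed.
  Within : Pred Vertex 0ℓ → Rel Vertex 0ℓ
  Within B x y = x ~ y × B x × B y

  Within-sym : ∀ {B x y} → Within B x y → Within B y x
  Within-sym (e , bx , by) = ~-sym e , by , bx

  -- Loop erasure: if `x` already occurs on the path built so far, everything before that occurrence
  -- is cut off.
  pathWithin : ∀ {B : Pred Vertex 0ℓ} {x y} → B x → Star (Within B) x y →
               Σ[ w ∈ Walk x y ] Unique (vertices w) × All B (vertices w)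
  pathWithin bx ε = ε , [] ∷ [] , bx ∷ []
  pathWithin {x = x} bx ((e , _ , by) ◅ w) with pathWithin by w
  ... | w′ , uw′ , Bw′ with x ∈? vertices w′
  ...   | no x∉w′ = e ◅ w′ , All.¬Any⇒All¬ _ x∉w′ ∷ uw′ , bx ∷ Bw′
  ...   | yes x∈w′ with suffixFrom G w′ x∈w′ uw′
  ...     | w″ , uw″ , w″⊆w′ = w″ , uw″ , All.tabulate (All.lookup Bw′ ∘ w″⊆w′)

-- Branch sets need not be connected: `link` only asks that the ends of the edges in use be
-- reachable from the centre. This suits colour-restricted graphs, in which a tree of the minor may
-- fall apart.
record MinorModel (K G : Graph) : Set₁ where
  private
    module K = Graph K
    module G = Graph G
  field
    branch   : K.Vertex → Pred G.Vertex 0ℓ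
    disjoint : ∀ {i j x} → branch i x → branch j x → i ≡ j
    centre   : K.Vertex → G.Vertex
    centre∈  : ∀ i → branch i (centre i)

  Reach : K.Vertex → Pred G.Vertex 0ℓ
  Reach i = Star (Within G (branch i)) (centre i)

  field
    link : ∀ {i j} → i K.~ j → ∃[ x ] ∃[ y ] Reach i x × Reach j y × x G.~ y

module _ {K G : Graph} (M : MinorModel K G) where
  private
    module K = Graph K
    module G = Graph G
  open MinorModel M

  private
    Reach⇒branch : ∀ {i x} → Reach i x → branch i x
    Reach⇒branch {i} = go (centre∈ i)
      where
      go : ∀ {x y} → branch i x → Star (Within G (branch i)) x y → branch i y
      go bx ε                  = bx
      go bx ((_ , _ , by) ◅ w) = go by w

    join : ∀ {i x y} → Reach i x → Reach i y →
           Σ[ w ∈ G.Walk x y ] Unique (G.vertices w) × All (branch i) (G.vertices w)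
    join ρ σ = pathWithin G (Reach⇒branch ρ) (reverse (Within-sym G) ρ ◅◅ σ)

  -- Each edge of `w` becomes a crossing edge, and the gaps are filled by paths inside the branches
  -- via their centres. The `All` component records which branches are visited; with their
  -- disjointness it keeps the pieces apart.
  liftPath : ∀ {i j x y} (w : K.Walk i j) → Unique (K.vertices w) → Reach i x → Reach j y →
             Σ[ w′ ∈ G.Walk x y ] Unique (G.vertices w′) ×
               All (λ z → Any (λ k → branch k z) (K.vertices w)) (G.vertices w′) ×
               K.walkLength w ≤ G.walkLength w′
  liftPath ε _ ρ σ with join ρ σ
  ... | w′ , uw′ , Bw′ = w′ , uw′ , All.map here Bw′ , z≤n
  liftPath {i} (e ◅ w) (i∉w ∷ uw) ρ σ with link e
  ... | _ , _ , ρ′ , σ′ , d with join ρ ρ′ | liftPath w uw σ′ σ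
  ...   | w₁ , uw₁ , Bw₁ | w₂ , uw₂ , Bw₂ , w≤w₂ =
    w₁ ◅◅ d ◅ w₂ ,
    subst Unique (sym eq) (++⁺ uw₁ uw₂ apart) ,
    subst (All _) (sym eq) (All.++⁺ (All.map here Bw₁) (All.map there Bw₂)) ,
    ≤-trans (s≤s w≤w₂) (walkLength-◅◅ G w₁ d w₂)
    where
    eq = vertices-◅◅ G w₁ d w₂
    apart : ∀ {z} → ¬ (z ∈ G.vertices w₁ × z ∈ G.vertices w₂)
    apart (z∈w₁ , z∈w₂) with find (All.lookup Bw₂ z∈w₂)
    ... | k , k∈w , kz = All.lookup i∉w k∈w (disjoint (All.lookup Bw₁ z∈w₁) kz)

  -- The closing edge is lifted first; its two ends are then prescribed as the ends of the lifted
  -- path.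
  liftCycle : (γ : K.Cycle) → Σ[ γ′ ∈ G.Cycle ] K.Cycle.cycleLength γ ≤ G.Cycle.cycleLength γ′
  liftCycle γ with link (K.Cycle.closing γ)
  ... | _ , _ , ρ , σ , d with liftPath (K.Cycle.path γ) (K.Cycle.distinct γ) σ ρ
  ...   | w′ , uw′ , _ , w≤w′ =
    record { path = w′ ; distinct = uw′ ; long = ≤-trans (K.Cycle.long γ) w≤w′ ; closing = d } , s≤s w≤w′

-- Subgraphs spanned by few colours

module _ (G : Graph) {k : ℕ} (c : Graph.EdgeColouring G k) where
  open Graph G
  open EdgeColouring c

  restrict : List (Fin k) → Graph
  restrict C = record
    { order    = order
    ; _~_      = λ x y → Σ[ e ∈ x ~ y ] colour e ∈ C
    ; _~?_     = dec
    ; ~-sym    = λ (e , e∈C) → ~-sym e , subst (_∈ C) (colour-sym e (~-sym e)) e∈C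
    ; ~-irrefl = λ (e , _) → ~-irrefl e
    }
    where
    dec : ∀ x y → Dec (Σ[ e ∈ x ~ y ] colour e ∈ C)
    dec x y with x ~? y
    ... | no ¬e = no (¬e ∘ proj₁)
    ... | yes e with colour e ∈? C
    ...   | yes e∈C = yes (e , e∈C)
    -- The colour does not depend on the adjacency proof: `e′` and `e` are both compared with
    -- `~-sym e`.
    ...   | no  e∉C = no λ (e′ , e′∈C) →
      e∉C (subst (_∈ C) (≡.trans (colour-sym e′ (~-sym e)) (sym (colour-sym e (~-sym e)))) e′∈C)

  module _ {C : List (Fin k)} where
    private module R = Graph (restrict C)

    forget : ∀ {x y} → R.Walk x y → Walk x y
    forget = gmap id proj₁

    vertices-forget : ∀ {x y} (w : R.Walk x y) → vertices (forget w) ≡ R.vertices w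
    vertices-forget ε       = refl
    vertices-forget (_ ◅ w) = cong (_ ∷_) (vertices-forget w)

    walkLength-forget : ∀ {x y} (w : R.Walk x y) → walkLength (forget w) ≡ R.walkLength w
    walkLength-forget ε       = refl
    walkLength-forget (_ ◅ w) = cong suc (walkLength-forget w)

    walkColours-forget : ∀ {x y} (w : R.Walk x y) → walkColours (forget w) ⊆ C
    walkColours-forget ((_ , e∈C) ◅ w) (here refl)  = e∈C
    walkColours-forget ((_ , e∈C) ◅ w) (there i∈w) = walkColours-forget w i∈w

    -- All colours on the cycle occur in `C`, and `C`, possibly with repetitions, is at least as
    -- long as the list of distinct ones.
    forgetCycle : (γ : R.Cycle) → Σ[ γ′ ∈ Cycle ]
                    Cycle.cycleLength γ′ ≡ R.Cycle.cycleLength γ × #colours γ′ ≤ length C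
    forgetCycle γ = record
      { path     = forget path
      ; distinct = subst Unique (sym (vertices-forget path)) distinct
      ; long     = subst (2 ≤_) (sym (walkLength-forget path)) long
      ; closing  = proj₁ closing
      } , cong suc (walkLength-forget path) ,
      unique-⊆⇒length≤ (deduplicate-! Fin._≟_ cs) (cs⊆C ∘ ∈-deduplicate⁻ Fin._≟_ cs)
      where
      open R.Cycle γ
      cs = colour (proj₁ closing) ∷ walkColours (forget path)
      cs⊆C : cs ⊆ C
      cs⊆C (here refl) = proj₂ closing
      cs⊆C (there i∈)  = walkColours-forget path i∈

  length-walkColours : ∀ {x y} (w : Walk x y) → length (walkColours w) ≡ walkLength w
  length-walkColours ε       = refl
  length-walkColours (_ ◅ w) = cong suc (length-walkColours w)

-- The colour classes of a shallow minor

module _ {G H : Graph} {r k : ℕ} (c : Graph.EdgeColouring G k) (S : ShallowMinor r H G) where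
  private
    module G = Graph G
    module H = Graph H
    module S = ShallowMinor S
    module T (i : H.Vertex) = RootedSubtree (S.Ts (Embedding.to S.embedding i))
  open Graph.EdgeColouring c

  private
    embed : ∀ i {u v} → Graph.Walk (T.tree i) u v → G.Walk (T.to i u) (T.to i v)
    embed i = gmap (T.to i) (Embedding.preserves (T.embedding i))

    walkLength-embed : ∀ i {u v} (w : Graph.Walk (T.tree i) u v) →
                       G.walkLength (embed i w) ≡ Graph.walkLength (T.tree i) w
    walkLength-embed i ε       = refl
    walkLength-embed i (_ ◅ w) = cong suc (walkLength-embed i w)

    stem : ∀ i u → List (Fin k)
    stem i u = walkColours (embed i (proj₁ (T.depth i u)))

    length-stem : ∀ i u → length (stem i u) ≤ r
    length-stem i u = ≤-trans
      (≤-reflexive (≡.trans (length-walkColours G c (embed i w)) (walkLength-embed i w))) w≤r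
      where
      w   = proj₁ (T.depth i u)
      w≤r = proj₂ (T.depth i u)

    edgeRoute : ∀ {i j} → Dec (i H.~ j) → List (Fin k)
    -- A default value: `route` is only consulted together with a proof of adjacency.
    edgeRoute         (no _)  = []
    edgeRoute {i} {j} (yes e) with Embedding.preserves S.embedding e
    ... | _ , u , v , d = stem i u ++ colour d ∷ stem j v

  -- The colours along a walk of length at most 2r+1 between the roots of the
  -- trees i and j. Going through the decision procedure makes the walk
  -- depend on i and j only.
  route : H.Vertex → H.Vertex → List (Fin k)
  route i j = edgeRoute (i H.~? j)

  route⊆word : ∀ {i j} → i H.~ j → ∃[ C ] route i j ⊆ toList {n = 2 * r + 1} C
  route⊆word {i} {j} e with i H.~? j
  ... | no ¬e = contradiction e ¬e
  ... | yes e with Embedding.preserves S.embedding e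
  -- Two stems of at most `r` colours and the crossing edge give `2 * r + 1`; the colour of the
  -- crossing edge also serves as padding.
  ...   | _ , u , v , d = short⇒⊆word (colour d) (stem i u ++ colour d ∷ stem j v) (begin
    length (stem i u ++ colour d ∷ stem j v)       ≡⟨ length-++ (stem i u) ⟩
    length (stem i u) + suc (length (stem j v))    ≤⟨ +-mono-≤ (length-stem i u) (s≤s (length-stem j v)) ⟩
    r + suc r                                      ≡⟨ cong (λ m → r + m) (+-comm 1 r) ⟩
    r + (r + 1)                                    ≡⟨ +-assoc r r 1 ⟨
    r + r + 1                                      ≡⟨ cong (λ m → r + m + 1) (+-identityʳ r) ⟨
    2 * r + 1                                      ∎)
    where open ≤-Reasoning

  -- `route i j` and `route j i` may follow different walks, so the disjunction is what makes
  -- adjacency symmetric. Classes may overlap, since a cover of the edges of `H` suffices.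
  class : List (Fin k) → Graph
  class C = record
    { order    = H.order
    ; _~_      = λ i j → i H.~ j × (route⊆ i j ⊎ route⊆ j i)
    ; _~?_     = λ i j → (i H.~? j) ×-dec (route⊆? i j ⊎-dec route⊆? j i)
    ; ~-sym    = λ (e , s) → H.~-sym e , Sum.swap s
    ; ~-irrefl = λ (e , _) → H.~-irrefl e
    }
    where
    route⊆ : Rel H.Vertex 0ℓ
    route⊆ i j = All (_∈ C) (route i j)
    route⊆? : ∀ i j → Dec (route⊆ i j)
    route⊆? i j = All.all? (_∈? C) (route i j)

  -- If the colours of a route lie in `C`, both stems and the crossing edge survive in
  -- `restrict G c C`, which is exactly what a link demands. The branch sets are the full vertex
  -- sets of the trees.
  class-model : ∀ C → MinorModel (class C) (restrict G c C)
  class-model C = record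
    { branch   = branch
    ; disjoint = disjoint
    ; centre   = λ i → T.to i (T.root i)
    ; centre∈  = λ i → T.root i , refl
    ; link     = λ { (e , inj₁ ⊆C) → link e ⊆C
                   ; (e , inj₂ ⊆C) → let (x , y , ρ , σ , d) = link (H.~-sym e) ⊆C
                                     in y , x , σ , ρ , Graph.~-sym (restrict G c C) d }
    }
    where
    branch : H.Vertex → Pred G.Vertex 0ℓ
    branch i x = ∃[ u ] T.to i u ≡ x

    disjoint : ∀ {i j x} → branch i x → branch j x → i ≡ j
    disjoint {i} {j} (u , u≡x) (v , v≡x) with i Fin.≟ j
    ... | yes i≡j = i≡j
    ... | no  i≢j = contradiction (≡.trans u≡x (sym v≡x))
                      (S.disjoint (i≢j ∘ Embedding.injective S.embedding) u v)

    Reach : H.Vertex → Pred G.Vertex 0ℓ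
    Reach i = Star (Within (restrict G c C) (branch i)) (T.to i (T.root i))

    within : ∀ i {u v} (w : Graph.Walk (T.tree i) u v) → All (_∈ C) (walkColours (embed i w)) →
             Star (Within (restrict G c C) (branch i)) (T.to i u) (T.to i v)
    within i ε       []            = ε
    within i (e ◅ w) (e∈C ∷ w⊆C) =
      ((Embedding.preserves (T.embedding i) e , e∈C) , (_ , refl) , (_ , refl)) ◅ within i w w⊆C

    link : ∀ {i j} → i H.~ j → All (_∈ C) (route i j) →
           ∃[ x ] ∃[ y ] Reach i x × Reach j y × Graph._~_ (restrict G c C) x y
    -- Splitting on the decision unfolds `route`, so the link uses the very walk whose colours were
    -- tested.
    link {i} {j} e ⊆C with i H.~? j
    ... | no ¬e = contradiction e ¬e
    ... | yes e with Embedding.preserves S.embedding e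
    ...   | _ , u , v , d with All.++⁻ (stem i u) ⊆C
    ...     | u⊆C , d∈C ∷ v⊆C = _ , _ , within i _ u⊆C , within j _ v⊆C , (d , d∈C)

  size-minor≤ : ∀ {b} → (∀ (C : Vec (Fin k) (2 * r + 1)) → Graph.size (class (toList C)) ≤ b) →
                H.size ≤ k ^ (2 * r + 1) * b
  size-minor≤ {b} bound = subst (λ l → H.size ≤ l * b) (length-words k (2 * r + 1))
    (length-filter-⋃
      (λ C (i , j) → (i Fin.<? j) ×-dec (Graph._~?_ (class (toList C)) i j))
      (cartesianProduct (allFin H.order) (allFin H.order)) bound (words k (2 * r + 1))
      (λ (i , j) → (i Fin.<? j) ×-dec (i H.~? j))
      λ (i<j , e) → let (C , ⊆C) = route⊆word e
                    in lose (∈-words C) (i<j , e , inj₁ (All.tabulate ⊆C)))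

-- From edge counts to densities

/-mono-≤ : ∀ {m n b} → m ≤ b * suc n → + m ℚ./ suc n ℚ.≤ + b ℚ./ 1
-- The quotients are stored in lowest terms, so they are compared by cross-multiplying unnormalised
-- representatives.
/-mono-≤ {m} {n} {b} m≤ = ℚ.toℚᵘ-cancel-≤ (begin
  ℚ.toℚᵘ (+ m ℚ./ suc n)  ≃⟨ ℚ.toℚᵘ-fromℚᵘ (mkℚᵘ (+ m) n) ⟩
  mkℚᵘ (+ m) n            ≤⟨ *≤* (≡.subst₂ ℤ._≤_ (ℤ.pos-* m 1) (ℤ.pos-* b (suc n))
                                  (ℤ.+≤+ (≤-trans (≤-reflexive (*-identityʳ m)) m≤))) ⟩
  mkℚᵘ (+ b) 0            ≃⟨ ℚ.toℚᵘ-fromℚᵘ (mkℚᵘ (+ b) 0) ⟨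
  ℚ.toℚᵘ (+ b ℚ./ 1)      ∎)
  where open ℚᵘ.≤-Reasoning

density≤ : ∀ H b → Graph.size H ≤ b * Graph.order H → density H ℚ.≤ + b ℚ./ 1
density≤ H b size≤b with Graph.order H | Graph.size H
-- The null graph has density `0ℚ` by convention, which is the value of `0 / 1`.
... | zero  | _ = /-mono-≤ {0} {0} {b} z≤n
... | suc n | m = /-mono-≤ {m} {n} {b} size≤b

mainTheorem3 : (f : ℕ → ℕ) → Unbounded f → f Preserves _≤_ ⟶ _≤_ → (∀ x → f x ≤ x) →
    (g : ℕ → ℕ) → (∀ p → Greatest _≤_ (λ i → f i ≤ p) (g p)) →
    (G : Graph) (r : ℕ) →
    (N : ℕ) → IsN f G (2 * r + 1) N →
    (∇ : ℚ) → Is∇ r G ∇ →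
    ∇ ℚ.≤ (+ (N ^ (2 * r + 1) * g (2 * r + 1) ^ 2)) ℚ./ 1
mainTheorem3 f _ _ f≤id g g-greatest G r N ((c , manyColours) , _) _ ((H , S , refl) , _) =
  -- The maximum is attained, so it is the density of a single minor `H`; likewise `c` is a
  -- colouring that attains `N`.
  density≤ H (N ^ p * d ^ 2) (begin
    Graph.size H                  ≤⟨ size-minor≤ c S (λ C → size≤ (class c S (toList C)) 1≤d (short C)) ⟩
    N ^ p * (n * d)               ≡⟨ cong (λ m → N ^ p * m) (*-comm n d) ⟩
    N ^ p * (d * n)               ≡⟨ *-assoc (N ^ p) d n ⟨
    N ^ p * d * n                 ≤⟨ *-monoˡ-≤ n (*-monoʳ-≤ (N ^ p) d≤d²) ⟩
    N ^ p * d ^ 2 * n             ∎)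
  where
  open ≤-Reasoning
  p = 2 * r + 1
  d = g p
  n = Graph.order H

  1≤d : 1 ≤ d
  -- Since `f 1 ≤ 1 ≤ p`, the index 1 competes in the maximum that defines `g p`.
  1≤d = proj₂ (g-greatest p) 1 (≤-trans (f≤id 1) (m≤n+m 1 (2 * r)))

  d≤d² : d ≤ d ^ 2
  d≤d² = ≤-trans (≤-reflexive (sym (*-identityʳ d)))
                 (*-monoʳ-≤ d (≤-trans 1≤d (≤-reflexive (sym (*-identityʳ d)))))

  short : ∀ C (γ : Graph.Cycle (class c S (toList C))) → Graph.Cycle.cycleLength γ ≤ d
  short C γ with liftCycle (class-model c S (toList C)) γ
  ... | γ′ , γ≤γ′ with forgetCycle G c γ′
  ...   | γ″ , γ″≡γ′ , few =
    ≤-trans γ≤γ′ (≤-trans (≤-reflexive (sym γ″≡γ′)) (proj₂ (g-greatest p) _ f≤p))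
    where
    f≤p : f (Graph.Cycle.cycleLength γ″) ≤ p
    -- The cycle has at most `p` colours but at least the minimum of `f` of its length and `p + 1`,
    -- so this minimum must be the former.
    f≤p with ⊓-sel (f (Graph.Cycle.cycleLength γ″)) (suc p)
           | ≤-trans (manyColours γ″) (≤-trans few (≤-reflexive (length-toList C)))
    ... | inj₁ eq | le = subst (_≤ p) eq le
    ... | inj₂ eq | le = contradiction (subst (_≤ p) eq le) (<-irrefl refl)
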